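{- Let $p$ be a nonnegative integer and let $t_m=m(m+1)/2$ denote the $m$-th triangular number. (i) For every even integer $n\ge 2$, $$ g\left(t_n,t_{n+1},t_{n+2};\,p(p+1)+\sum_{j=1}^p\left\lceil\frac{6 j}{n}\right\rceil\right)=\frac{(n+1)(n+2)\bigl(2(n+3)p+3 n\bigr)}{4}-1\,. $$ (ii) For every odd integer $n\ge 3$, $$ g\left(t_n,t_{n+1},t_{n+2};\,\sum_{j=1}^p\left\lceil\frac{j}{2}\left(1+\frac{3}{n}\right)\right\rceil\right)=\frac{(n+1)(n+2)\bigl((n+3)p+3(n-1)\bigr)}{4}-1\,. $$
   Context: For positive integers $a_1,\dots,a_k$ with $\gcd(a_1,\dots,a_k)=1$ and an integer $N$, let $d(N;a_1,\dots,a_k)$ denote the number of $k$-tuples $(x_1,\dots,x_k)$ of nonnegative integers with $a_1x_1+\cdots+a_kx_k=N$. For a nonnegative integer $q$, the generalized Frobenius number $g(a_1,\dots,a_k;q)$ is the largest integer $N$ such that $d(N;a_1,\dots,a_k)\le q$ (so every integer larger than it has at least $q+1$ representations; $q=0$ gives the classical Frobenius number). An empty sum equals $0$. It is known that $\gcd(t_n,t_{n+1},t_{n+2})=1$. -}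

module Defs where

open import Data.Nat using (ℕ; zero; suc; _+_; _*_; _∸_; _≤_; _<_; _≤ᵇ_)
open import Data.Nat.DivMod using (_/_)
open import Data.List using (List; []; _∷_)
open import Data.Bool using (if_then_else_)
open import Data.Product using (_×_)

tri : ℕ → ℕ
tri m = (m * suc m) / 2

-- ceiling division ⌈ a / b ⌉ (convention: 0 when b = 0; never used with b = 0)
ceilDiv : ℕ → ℕ → ℕ
ceilDiv a zero = 0
ceilDiv a (suc b) = (a + b) / suc b

sumTo : ℕ → (ℕ → ℕ) → ℕ
sumTo zero f = 0
sumTo (suc p) f = sumTo p f + f (suc p)

mutual
  -- d N as : number of tuples (x₁,…,x_k) ∈ ℕ^k with Σ aᵢ xᵢ = N
  -- (valid for positive coefficients aᵢ; x₁ ranges over 0..N)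
  d : ℕ → List ℕ → ℕ
  d zero [] = 1
  d (suc N) [] = 0
  d N (a ∷ as) = sumX N N a as

  sumX : ℕ → ℕ → ℕ → List ℕ → ℕ
  sumX zero N a as = d N as
  sumX (suc k) N a as =
    sumX k N a as + (if (a * suc k) ≤ᵇ N then d (N ∸ a * suc k) as else 0)

-- N is the generalized Frobenius number g(as; q): the largest integer N with d(N; as) ≤ q.
-- (Negative integers always have 0 ≤ q representations, so for N ∈ ℕ it suffices to
-- quantify over larger naturals.)
IsGenFrobenius : List ℕ → ℕ → ℕ → Set
IsGenFrobenius as q N = (d N as ≤ q) × (∀ M → N < M → q < d M as)

{-# OPTIONS --safe #-}
module Submission where

-- In both parities the three triangular numbers have the shape m A, m B, c = B e, with c
-- invertible modulo m and A invertible modulo B (n = 2k: m = 2k+1, A = k, B = k+1, e = 2k+3;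
-- n = 2k+1: m = k+1, A = 2k+1, B = 2k+3, e = k+2). Every integer N is uniquely
-- c r + m (A s + B K) with 0 ≤ r < m and 0 ≤ s < B; in a solution z = r + m w and x = s + B u,
-- and then y = K - A u - e w. Hence d(N) counts the (u , w) in ℕ² with A u + e w ≤ K, which is
-- monotone in K. At K = e p - 1 the count is ∑_{j ≤ p} ⌈ e j / A ⌉, at K = e p the point (0 , p)
-- is new, and the largest N with K = e p - 1 is the one with r = m - 1, s = B - 1.

open import Defs
open import Data.Bool using (T; true; false; if_then_else_)
open import Data.Fin using (Fin; zero; suc)
open import Data.Fin.Properties using (injective⇒≤)
open import Data.List using (List; _∷_; []; _++_; map; length; lookup; upTo)
open import Data.List.Properties using (length-map; length-++; length-upTo)
open import Data.List.Membership.Propositional using (_∈_)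
open import Data.List.Membership.Propositional.Properties
  using (∈-map⁺; ∈-map⁻; ∈-++⁺ˡ; ∈-++⁺ʳ; ∈-++⁻; ∈-upTo⁺; ∈-upTo⁻; ∈-lookup)
open import Data.List.Relation.Binary.Subset.Propositional using (_⊆_)
open import Data.List.Relation.Unary.All as All using (All; []; _∷_)
open import Data.List.Relation.Unary.AllPairs using ([]; _∷_)
open import Data.List.Relation.Unary.Any using (here; there; index)
open import Data.List.Relation.Unary.Any.Properties using (lookup-index)
open import Data.List.Relation.Unary.Unique.Propositional using (Unique)
open import Data.List.Relation.Unary.Unique.Propositional.Properties as Unique using ()
open import Data.Nat using (ℕ; zero; suc; pred; _+_; _*_; _∸_; _≤_; _<_; _≤ᵇ_; z≤n; s≤s;
  NonZero; >-nonZero)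
open import Data.Nat.Divisibility
  using (_∣_; divides; ∣m+n∣m⇒∣n; m∣m*n; n∣m*n; ∣m⇒∣m*n)
open import Data.Nat.DivMod
  using (_/_; _%_; m≡m%n+[m/n]*n; m%n<n; m/n*n≤m; m*n/n≡m; /-monoˡ-≤; +-distrib-/-∣ˡ)
open import Data.Nat.Properties
open import Data.Nat.Tactic.RingSolver using (solve-∀)
open import Data.Product using (_×_; _,_; ∃; ∃₂; proj₁; proj₂; map₂)
open import Data.Sum using (inj₁; inj₂)
open import Data.Vec using (Vec; []; _∷_)
open import Data.Vec.Properties using (∷-injectiveˡ; ∷-injectiveʳ)
open import Relation.Binary.PropositionalEquality
open import Relation.Nullary using (¬_; contradiction)

-- Comparing lengths of lists without repetitions.

module _ {A : Set} where

  lookup-injective : {xs : List A} → Unique xs → ∀ i j → lookup xs i ≡ lookup xs j → i ≡ j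
  lookup-injective (_ ∷ _) zero zero _ = refl
  lookup-injective (x∉ ∷ _) zero (suc j) eq = contradiction eq (All.lookup x∉ (∈-lookup j))
  lookup-injective (x∉ ∷ _) (suc i) zero eq = contradiction (sym eq) (All.lookup x∉ (∈-lookup i))
  lookup-injective (_ ∷ u) (suc i) (suc j) eq = cong suc (lookup-injective u i j eq)

  -- Pigeonhole: send each position of `xs` to a position of the same element in `ys`. Equal images
  -- carry equal elements, which in `xs` occur only once.
  Unique-⊆⇒length≤ : {xs ys : List A} → Unique xs → xs ⊆ ys → length xs ≤ length ys
  Unique-⊆⇒length≤ {xs} {ys} u sub = injective⇒≤ {f = f} f-injective
    where
    f : Fin (length xs) → Fin (length ys)
    f i = index (sub (∈-lookup i))

    f-injective : ∀ {i j} → f i ≡ f j → i ≡ j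
    f-injective {i} {j} eq = lookup-injective u i j
      (trans (lookup-index (sub (∈-lookup i)))
        (trans (cong (lookup ys) eq) (sym (lookup-index (sub (∈-lookup j))))))

-- Explicit lists of the representations counted by `d`.

weight : (as : List ℕ) → Vec ℕ (length as) → ℕ
weight [] [] = 0
weight (a ∷ as) (x ∷ xs) = a * x + weight as xs

mutual
  -- Follows the recursion of `d` and `sumX`, with concatenation for addition, so that its length is
  -- `d N as` by induction.
  tuples : ℕ → (as : List ℕ) → List (Vec ℕ (length as))
  tuples N (a ∷ as) = tuplesUpTo N N a as
  tuples zero [] = [] ∷ []
  tuples (suc N) [] = []

  tuplesUpTo : ℕ → ℕ → (a : ℕ) (as : List ℕ) → List (Vec ℕ (suc (length as)))
  tuplesUpTo zero N a as = map (0 ∷_) (tuples N as)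
  tuplesUpTo (suc k) N a as = tuplesUpTo k N a as ++
    (if a * suc k ≤ᵇ N then map (suc k ∷_) (tuples (N ∸ a * suc k) as) else [])

mutual
  length-tuples : ∀ N as → length (tuples N as) ≡ d N as
  length-tuples zero [] = refl
  length-tuples (suc N) [] = refl
  length-tuples zero (a ∷ as) = length-tuplesUpTo zero zero a as
  length-tuples (suc N) (a ∷ as) = length-tuplesUpTo (suc N) (suc N) a as

  length-tuplesUpTo : ∀ k N a as → length (tuplesUpTo k N a as) ≡ sumX k N a as
  length-tuplesUpTo zero N a as = trans (length-map _ (tuples N as)) (length-tuples N as)
  length-tuplesUpTo (suc k) N a as =
    trans (length-++ (tuplesUpTo k N a as)) (cong₂ _+_ (length-tuplesUpTo k N a as) lastTerm)
    where
    lastTerm : length (if a * suc k ≤ᵇ N then map (suc k ∷_) (tuples (N ∸ a * suc k) as) else [])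
      ≡ (if a * suc k ≤ᵇ N then d (N ∸ a * suc k) as else 0)
    lastTerm with a * suc k ≤ᵇ N
    ... | false = refl
    ... | true = trans (length-map _ (tuples (N ∸ a * suc k) as)) (length-tuples _ as)

mutual
  ∈-tuples⁻ : ∀ N as {xs} → xs ∈ tuples N as → weight as xs ≡ N
  ∈-tuples⁻ zero [] (here refl) = refl
  ∈-tuples⁻ N (a ∷ as) {x ∷ xs} mem = proj₂ (∈-tuplesUpTo⁻ N N a as mem)

  -- The bound on `x` is carried along because it keeps the piece with first entry `suc k` disjoint
  -- from the earlier ones in `tuplesUpTo-unique`.
  ∈-tuplesUpTo⁻ : ∀ k N a as {x xs} → x ∷ xs ∈ tuplesUpTo k N a as →
    x ≤ k × a * x + weight as xs ≡ N
  ∈-tuplesUpTo⁻ zero N a as mem with ∈-map⁻ _ mem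
  ... | xs , mem′ , refl = z≤n , trans (cong (_+ weight as xs) (*-zeroʳ a)) (∈-tuples⁻ N as mem′)
  ∈-tuplesUpTo⁻ (suc k) N a as mem with ∈-++⁻ (tuplesUpTo k N a as) mem
  ... | inj₁ mem′ with ∈-tuplesUpTo⁻ k N a as mem′
  ...   | x≤k , eq = m≤n⇒m≤1+n x≤k , eq
  ∈-tuplesUpTo⁻ (suc k) N a as mem | inj₂ mem′ with a * suc k ≤ᵇ N in eq
  ... | true with ∈-map⁻ _ mem′
  ...   | xs , mem″ , refl = ≤-refl , trans (cong (a * suc k +_) (∈-tuples⁻ _ as mem″))
                                        (m+[n∸m]≡n (≤ᵇ⇒≤ (a * suc k) _ (subst T (sym eq) _)))

mutual
  -- Since each coefficient is positive, x ≤ a x ≤ N, so searching x in 0..N misses no solution.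
  ∈-tuples⁺ : ∀ {N as} → All NonZero as → ∀ xs → weight as xs ≡ N → xs ∈ tuples N as
  ∈-tuples⁺ [] [] refl = here refl
  ∈-tuples⁺ {N} {a ∷ as} nz@(a≢0 ∷ _) (x ∷ xs) eq =
    ∈-tuplesUpTo⁺ N nz (≤-trans (m≤n*m x a {{a≢0}}) (≤-trans (m≤m+n _ _) (≤-reflexive eq))) eq

  ∈-tuplesUpTo⁺ : ∀ k {N a as} → All NonZero (a ∷ as) → ∀ {x xs} → x ≤ k →
    a * x + weight as xs ≡ N → x ∷ xs ∈ tuplesUpTo k N a as
  ∈-tuplesUpTo⁺ zero {a = a} {as} (_ ∷ nz) {xs = xs} z≤n eq =
    ∈-map⁺ _ (∈-tuples⁺ nz xs (trans (cong (_+ weight as xs) (sym (*-zeroʳ a))) eq))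
  ∈-tuplesUpTo⁺ (suc k) {N} {a} {as} nz {x} {xs} x≤1+k eq with m≤n⇒m<n∨m≡n x≤1+k
  ... | inj₁ (s≤s x≤k) = ∈-++⁺ˡ (∈-tuplesUpTo⁺ k nz x≤k eq)
  ... | inj₂ refl = ∈-++⁺ʳ (tuplesUpTo k N a as) inLast
    where
    ax≤N : a * suc k ≤ N
    ax≤N = ≤-trans (m≤m+n _ _) (≤-reflexive eq)

    inLast : suc k ∷ xs ∈
      (if a * suc k ≤ᵇ N then map (suc k ∷_) (tuples (N ∸ a * suc k) as) else [])
    inLast with a * suc k ≤ᵇ N | ≤⇒≤ᵇ ax≤N
    ... | true | _ = ∈-map⁺ _ (∈-tuples⁺ (All.tail nz) xs
      (sym (trans (cong (_∸ a * suc k) (sym eq)) (m+n∸m≡n (a * suc k) _))))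

mutual
  tuples-unique : ∀ N as → Unique (tuples N as)
  tuples-unique zero [] = [] ∷ []
  tuples-unique (suc N) [] = []
  tuples-unique N (a ∷ as) = tuplesUpTo-unique N N a as

  tuplesUpTo-unique : ∀ k N a as → Unique (tuplesUpTo k N a as)
  tuplesUpTo-unique zero N a as = Unique.map⁺ ∷-injectiveʳ (tuples-unique N as)
  tuplesUpTo-unique (suc k) N a as with a * suc k ≤ᵇ N
  ... | false = Unique.++⁺ (tuplesUpTo-unique k N a as) [] λ ()
  ... | true = Unique.++⁺ (tuplesUpTo-unique k N a as)
    (Unique.map⁺ ∷-injectiveʳ (tuples-unique _ as)) disjoint
    where
    disjoint : ∀ {xs} → ¬ (xs ∈ tuplesUpTo k N a as ×
      xs ∈ map (suc k ∷_) (tuples (N ∸ a * suc k) as))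
    disjoint (mem , mem′) with ∈-map⁻ _ mem′
    ... | _ , _ , refl = 1+n≰n (proj₁ (∈-tuplesUpTo⁻ k N a as mem))

-- This and `length≤d` reduce bounds on `d` to exhibiting one list: a complete one from above, a
-- sound one without repetitions from below.
d≤length : ∀ {N as} ys → (∀ xs → weight as xs ≡ N → xs ∈ ys) → d N as ≤ length ys
d≤length {N} {as} ys complete = subst (_≤ length ys) (length-tuples N as)
  (Unique-⊆⇒length≤ (tuples-unique N as) λ {xs} mem → complete xs (∈-tuples⁻ N as mem))

length≤d : ∀ {N as} ys → All NonZero as → Unique ys →
  (∀ {xs} → xs ∈ ys → weight as xs ≡ N) → length ys ≤ d N as
length≤d {N} {as} ys nz u sound = subst (length ys ≤_) (length-tuples N as)
  (Unique-⊆⇒length≤ u λ {xs} mem → ∈-tuples⁺ nz xs (sound mem))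

-- Ceiling division and finite sums.

-- With its converse this characterises the ceiling by the numbers below it: a (u + 1) ≤ x + (a - 1)
-- exactly when a u < x.
<-ceilDiv⁺ : ∀ {u} x a .{{_ : NonZero a}} → a * u < x → u < ceilDiv x a
<-ceilDiv⁺ {u} x (suc b) au<x = subst (_≤ (x + b) / suc b) (m*n/n≡m (suc u) (suc b))
  (/-monoˡ-≤ (suc b) (begin
    suc u * suc b         ≡⟨ rearrange u b ⟩
    suc (suc b * u) + b   ≤⟨ +-monoˡ-≤ b au<x ⟩
    x + b                 ∎))
  where
  open ≤-Reasoning
  rearrange : ∀ u b → (1 + u) * (1 + b) ≡ 1 + (1 + b) * u + b
  rearrange = solve-∀

<-ceilDiv⁻ : ∀ {u} x a .{{_ : NonZero a}} → u < ceilDiv x a → a * u < x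
<-ceilDiv⁻ {u} x (suc b) u< = +-cancelʳ-≤ b _ _ (begin
    suc (suc b * u) + b           ≡⟨ rearrange u b ⟩
    suc u * suc b                 ≤⟨ *-monoˡ-≤ (suc b) u< ⟩
    (x + b) / suc b * suc b       ≤⟨ m/n*n≤m (x + b) (suc b) ⟩
    x + b                         ∎)
  where
  open ≤-Reasoning
  rearrange : ∀ u b → 1 + (1 + b) * u + b ≡ (1 + u) * (1 + b)
  rearrange = solve-∀

-- Both sides have the same numbers below them, because 2 a u < 2 x exactly when a u < x.
ceilDiv-cancel-2 : ∀ x a .{{_ : NonZero a}} → ceilDiv (2 * x) (2 * a) ≡ ceilDiv x a
ceilDiv-cancel-2 x a@(suc _) = <-ext λ u →
    (λ u< → <-ceilDiv⁺ x a (*-cancelˡ-< 2 _ _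
      (subst (_< 2 * x) (*-assoc 2 a u) (<-ceilDiv⁻ (2 * x) (2 * a) u<))))
  , (λ u< → <-ceilDiv⁺ (2 * x) (2 * a)
      (subst (_< 2 * x) (sym (*-assoc 2 a u)) (*-monoʳ-< 2 (<-ceilDiv⁻ x a u<))))
  where
  <-ext : ∀ {m n} → (∀ u → (u < m → u < n) × (u < n → u < m)) → m ≡ n
  <-ext h = ≤-antisym (≮⇒≥ λ n<m → <-irrefl refl (proj₁ (h _) n<m))
                      (≮⇒≥ λ m<n → <-irrefl refl (proj₂ (h _) m<n))

ceilDiv-+-* : ∀ q x a .{{_ : NonZero a}} → ceilDiv (q * a + x) a ≡ q + ceilDiv x a
ceilDiv-+-* q x (suc b) = begin
  (q * suc b + x + b) / suc b              ≡⟨ cong (_/ suc b) (+-assoc (q * suc b) x b) ⟩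
  (q * suc b + (x + b)) / suc b            ≡⟨ +-distrib-/-∣ˡ (x + b) (n∣m*n q) ⟩
  q * suc b / suc b + (x + b) / suc b      ≡⟨ cong (_+ (x + b) / suc b) (m*n/n≡m q (suc b)) ⟩
  q + (x + b) / suc b                      ∎
  where open ≡-Reasoning

sumTo-cong : ∀ p {f g} → (∀ j → f j ≡ g j) → sumTo p f ≡ sumTo p g
sumTo-cong zero f≗g = refl
sumTo-cong (suc p) f≗g = cong₂ _+_ (sumTo-cong p f≗g) (f≗g (suc p))

sumTo-2*j+ : ∀ p f → sumTo p (λ j → 2 * j + f j) ≡ p * (p + 1) + sumTo p f
sumTo-2*j+ zero f = refl
sumTo-2*j+ (suc p) f = trans (cong (_+ (2 * suc p + f (suc p))) (sumTo-2*j+ p f))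
  (rearrange p (sumTo p f) (f (suc p)))
  where
  rearrange : ∀ p s y → p * (p + 1) + s + (2 * (1 + p) + y) ≡ (1 + p) * (1 + p + 1) + (s + y)
  rearrange = solve-∀

-- Lattice points of the first quadrant below a line.

module _ (A e : ℕ) .{{_ : NonZero A}} where

  -- The pairs (u , w) with A u + e w < e p, listed by rows; row w has ⌈ e (p - w) / A ⌉ points.
  latticePoints : ℕ → List (ℕ × ℕ)
  latticePoints zero = []
  latticePoints (suc p) =
    map (map₂ suc) (latticePoints p) ++ map (_, 0) (upTo (ceilDiv (e * suc p) A))

  length-latticePoints : ∀ p → length (latticePoints p) ≡ sumTo p (λ j → ceilDiv (e * j) A)
  length-latticePoints zero = refl
  length-latticePoints (suc p) = trans (length-++ (map _ (latticePoints p)))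
    (cong₂ _+_ (trans (length-map _ (latticePoints p)) (length-latticePoints p))
               (trans (length-map _ (upTo (ceilDiv (e * suc p) A))) (length-upTo (ceilDiv (e * suc p) A))))

  private
    shift : ∀ u w → A * u + e * suc w ≡ e + (A * u + e * w)
    shift = shift′ A e
      where
      shift′ : ∀ A e u w → A * u + e * (1 + w) ≡ e + (A * u + e * w)
      shift′ = solve-∀

    base : ∀ u → A * u ≡ A * u + e * 0
    base u = sym (trans (cong (A * u +_) (*-zeroʳ e)) (+-identityʳ (A * u)))

  -- Raising both `w` and `p` by one adds `e` to each side, which handles the shifted rows; row 0 is
  -- the characterisation of `ceilDiv`.
  ∈-latticePoints⁻ : ∀ p {u w} → (u , w) ∈ latticePoints p → A * u + e * w < e * p
  ∈-latticePoints⁻ (suc p) mem with ∈-++⁻ (map (map₂ suc) (latticePoints p)) mem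
  ... | inj₁ mem′ with ∈-map⁻ _ mem′
  ...   | (u , w) , mem″ , refl = subst₂ _<_ (sym (shift u w)) (sym (*-suc e p))
            (+-monoʳ-< e (∈-latticePoints⁻ p mem″))
  ∈-latticePoints⁻ (suc p) mem | inj₂ mem′ with ∈-map⁻ _ mem′
  ... | u , mem″ , refl = subst (_< e * suc p) (base u) (<-ceilDiv⁻ (e * suc p) A (∈-upTo⁻ mem″))

  ∈-latticePoints⁺ : ∀ p u w → A * u + e * w < e * p → (u , w) ∈ latticePoints p
  ∈-latticePoints⁺ zero u w lt = contradiction (≤-trans lt (≤-reflexive (*-zeroʳ e))) λ ()
  ∈-latticePoints⁺ (suc p) u zero lt = ∈-++⁺ʳ (map (map₂ suc) (latticePoints p))
    (∈-map⁺ _ (∈-upTo⁺ (<-ceilDiv⁺ (e * suc p) A (subst (_< e * suc p) (sym (base u)) lt))))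
  ∈-latticePoints⁺ (suc p) u (suc w) lt = ∈-++⁺ˡ (∈-map⁺ _ (∈-latticePoints⁺ p u w
    (+-cancelˡ-< e _ _ (subst₂ _<_ (shift u w) (*-suc e p) lt))))

  latticePoints-unique : ∀ p → Unique (latticePoints p)
  latticePoints-unique zero = []
  latticePoints-unique (suc p) = Unique.++⁺
    (Unique.map⁺ (λ { refl → refl }) (latticePoints-unique p))
    (Unique.map⁺ (λ { refl → refl }) (Unique.upTo⁺ _)) disjoint
    where
    disjoint : ∀ {x} → ¬ (x ∈ map (map₂ suc) (latticePoints p) ×
      x ∈ map (_, 0) (upTo (ceilDiv (e * suc p) A)))
    disjoint (mem , mem′) with ∈-map⁻ _ mem | ∈-map⁻ _ mem′
    ... | _ , _ , refl | _ , _ , ()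

-- Arithmetic modulo m with a coefficient c that has inverse i.

module _ (c : ℕ) {i m v : ℕ} (c*i≡1+m*v : c * i ≡ 1 + m * v) where

  -- Multiplying c x by the inverse i gives x plus a multiple of m.
  ∣-cancel-invertible : ∀ {x} → m ∣ c * x → m ∣ x
  ∣-cancel-invertible {x} m∣cx = ∣m+n∣m⇒∣n
    (subst (m ∣_) (trans (expand c i x) (trans (cong (_* x) c*i≡1+m*v) (collect m v x)))
      (∣m⇒∣m*n i m∣cx))
    (m∣m*n (v * x))
    where
    expand : ∀ c i x → c * x * i ≡ c * i * x
    expand = solve-∀
    collect : ∀ m v x → (1 + m * v) * x ≡ m * (v * x) + x
    collect = solve-∀

  -- Take r = N i mod m, so that c r ≡ N modulo m. The quotient is t = c q - v N, where q = N i / m;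
  -- the computation adds m v N to both sides to stay within ℕ.
  represent : .{{_ : NonZero m}} → ∀ N → c * pred m ≤ N →
    ∃₂ λ r t → r ≤ pred m × N ≡ c * r + m * t
  represent N large = r , t , r≤ , +-cancelʳ-≡ (m * (v * N)) _ _ (begin
      N + m * (v * N)              ≡⟨ sym eq ⟩
      c * r + m * (c * q)          ≡⟨ cong (λ s → c * r + m * s) (sym vN+t≡cq) ⟩
      c * r + m * (v * N + t)      ≡⟨ distribute (c * r) m (v * N) t ⟩
      c * r + m * t + m * (v * N)  ∎)
    where
    open ≡-Reasoning
    factor : ∀ c r m q → c * r + m * (c * q) ≡ c * (r + q * m)
    factor = solve-∀
    swap : ∀ c N i → c * (N * i) ≡ c * i * N
    swap = solve-∀
    expand : ∀ m v N → (1 + m * v) * N ≡ N + m * (v * N)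
    expand = solve-∀
    distribute : ∀ x m y t → x + m * (y + t) ≡ x + m * t + m * y
    distribute = solve-∀

    r q : ℕ
    r = N * i % m
    q = N * i / m

    r≤ : r ≤ pred m
    r≤ = <⇒≤pred (m%n<n (N * i) m)

    eq : c * r + m * (c * q) ≡ N + m * (v * N)
    eq = begin
      c * r + m * (c * q)  ≡⟨ factor c r m q ⟩
      c * (r + q * m)      ≡⟨ cong (c *_) (sym (m≡m%n+[m/n]*n (N * i) m)) ⟩
      c * (N * i)          ≡⟨ swap c N i ⟩
      c * i * N            ≡⟨ cong (_* N) c*i≡1+m*v ⟩
      (1 + m * v) * N      ≡⟨ expand m v N ⟩
      N + m * (v * N)      ∎

    -- As c r ≤ c (m - 1) ≤ N, cancelling N in `eq` leaves m v N ≤ m c q; hence the subtraction in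
    -- `t` is exact.
    vN≤cq : v * N ≤ c * q
    vN≤cq = *-cancelˡ-≤ m (+-cancelˡ-≤ N _ _ (≤-trans (≤-reflexive (sym eq))
      (+-monoˡ-≤ (m * (c * q)) (≤-trans (*-monoʳ-≤ c r≤) large))))

    t : ℕ
    t = c * q ∸ v * N

    vN+t≡cq : v * N + t ≡ c * q
    vN+t≡cq = m+[n∸m]≡n vN≤cq

-- The generalized Frobenius number of m A, m B, B e.

module _ (A B′ m′ e : ℕ) .{{_ : NonZero A}} .{{_ : NonZero e}}
  {i v i′ v′ : ℕ}
  (A*i≡1+B*v : A * i ≡ 1 + suc B′ * v) (c*i′≡1+m*v′ : suc B′ * e * i′ ≡ 1 + suc m′ * v′)
  where

  private
    -- With the predecessors `B′` and `m′` as parameters, the largest residues modulo B and m are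
    -- available without subtraction.
    B m c : ℕ
    B = suc B′
    m = suc m′
    c = B * e

    coefficients : List ℕ
    coefficients = m * A ∷ m * B ∷ c ∷ []

    -- (x , y , z) for N = c r + m (A s + B K): here s = x mod B and r = z mod m are determined by N.
    solution : ℕ → ℕ → ℕ → ℕ × ℕ → Vec ℕ 3
    solution s r K (u , w) = (s + u * B) ∷ (K ∸ (A * u + e * w)) ∷ (r + w * m) ∷ []

    solution-injective : ∀ {s r K x y} → solution s r K x ≡ solution s r K y → x ≡ y
    solution-injective {s} {r} eq = cong₂ _,_
      (*-cancelʳ-≡ _ _ B (+-cancelˡ-≡ s _ _ (∷-injectiveˡ eq)))
      (*-cancelʳ-≡ _ _ m (+-cancelˡ-≡ r _ _ (∷-injectiveˡ (∷-injectiveʳ (∷-injectiveʳ eq)))))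

    -- The hypothesis makes the truncated subtraction in the middle coordinate exact.
    weight-solution : ∀ {s r K} x → A * proj₁ x + e * proj₂ x ≤ K →
      weight coefficients (solution s r K x) ≡ c * r + m * (A * s + B * K)
    weight-solution {s} {r} {K} (u , w) le =
      trans (collect A B m e s r u w (K ∸ (A * u + e * w)))
        (cong (λ K → c * r + m * (A * s + B * K)) (m+[n∸m]≡n le))
      where
      collect : ∀ A B m e s r u w y →
        m * A * (s + u * B) + (m * B * y + (B * e * (r + w * m) + 0))
          ≡ B * e * r + m * (A * s + B * (A * u + e * w + y))
      collect = solve-∀

    regroup-bound : ∀ x m A B B′ y → x + m * (A * B′ + B * y) ≡ x + B′ * (m * A) + m * B * y
    regroup-bound = solve-∀

  -- The equation says that N has r = m - 1, s = B - 1 and K = e p - 1; m B stands on the left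
  -- because K = -1 when p = 0. Every solution is shown to come from a lattice point with A u + e w
  -- < e p, by reducing first modulo m, then modulo B.
  count-at-frobenius : ∀ p N → N + m * B ≡ m′ * c + B′ * (m * A) + m * B * (e * p) →
    d N coefficients ≤ sumTo p (λ j → ceilDiv (e * j) A)
  count-at-frobenius p N N-eq = subst (d N coefficients ≤_)
    (trans (length-map _ (latticePoints A e p)) (length-latticePoints A e p))
    -- For p = 0 the default `pred 0` = 0 is harmless: there are no lattice points to map.
    (d≤length (map (solution B′ m′ (pred (e * p))) (latticePoints A e p)) complete)
    where
    complete : ∀ xs → weight coefficients xs ≡ N →
      xs ∈ map (solution B′ m′ (pred (e * p))) (latticePoints A e p)
    complete (x ∷ y ∷ z ∷ []) eq = reduce-z (∣-cancel-invertible c c*i′≡1+m*v′ m∣c*[1+z])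
      where
      open ≡-Reasoning

      -- Adding c completes c (m - 1) to c m, so that m divides c (1 + z): the residue of z is m -
      -- 1.
      eq₁ : m * (A * x + B * y + B) + c * suc z ≡ m * (c + A * B′ + B * (e * p))
      eq₁ = begin
        m * (A * x + B * y + B) + c * suc z
          ≡⟨ regroup m A B e x y z ⟩
        m * A * x + (m * B * y + (c * z + 0)) + m * B + c
          ≡⟨ cong (λ N → N + m * B + c) eq ⟩
        N + m * B + c
          ≡⟨ cong (_+ c) N-eq ⟩
        m′ * c + B′ * (m * A) + m * B * (e * p) + c
          ≡⟨ regroup′ m′ A B B′ e p ⟩
        m * (c + A * B′ + B * (e * p)) ∎
        where
        regroup : ∀ m A B e x y z → m * (A * x + B * y + B) + B * e * (1 + z)
          ≡ m * A * x + (m * B * y + (B * e * z + 0)) + m * B + B * e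
        regroup = solve-∀
        regroup′ : ∀ m′ A B B′ e p →
          m′ * (B * e) + B′ * ((1 + m′) * A) + (1 + m′) * B * (e * p) + B * e
          ≡ (1 + m′) * (B * e + A * B′ + B * (e * p))
        regroup′ = solve-∀

      m∣c*[1+z] : m ∣ c * suc z
      m∣c*[1+z] = ∣m+n∣m⇒∣n (subst (m ∣_) (sym eq₁) (m∣m*n _)) (m∣m*n (A * x + B * y + B))

      reduce-x : ∀ w → z ≡ m′ + w * m → B * (e * w + y + 1) + A * suc x ≡ B * (A + e * p) →
        B ∣ suc x → x ∷ y ∷ z ∷ [] ∈ map (solution B′ m′ (pred (e * p))) (latticePoints A e p)
      reduce-x w refl eq₂ (divides (suc u) refl) =
        subst (λ y → x ∷ y ∷ z ∷ [] ∈ map (solution B′ m′ (pred (e * p))) (latticePoints A e p))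
          (trans (cong (_∸ (A * u + e * w)) (cong pred (sym eq₃))) (m+n∸m≡n (A * u + e * w) y))
          (∈-map⁺ (solution B′ m′ (pred (e * p))) (∈-latticePoints⁺ A e p u w
            (≤-trans (s≤s (m≤m+n _ y)) (≤-reflexive eq₃))))
        where
        -- This is A u + e w + y = K for K = e p - 1; it yields both the lattice point inequality
        -- and the value of y.
        eq₃ : 1 + (A * u + e * w + y) ≡ e * p
        eq₃ = +-cancelˡ-≡ A _ _ (*-cancelˡ-≡ _ _ B (trans (regroup A B e u w y) eq₂))
          where
          regroup : ∀ A B e u w y → B * (A + (1 + (A * u + e * w + y)))
            ≡ B * (e * w + y + 1) + A * ((1 + u) * B)
          regroup = solve-∀

      reduce-z : m ∣ suc z →
        x ∷ y ∷ z ∷ [] ∈ map (solution B′ m′ (pred (e * p))) (latticePoints A e p)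
      reduce-z (divides (suc w) 1+z≡) = reduce-x w (suc-injective 1+z≡) eq₂
        (∣-cancel-invertible A A*i≡1+B*v
          (∣m+n∣m⇒∣n (subst (B ∣_) (sym eq₂) (m∣m*n _)) (m∣m*n (e * w + y + 1))))
        where
        -- The same device modulo B: adding A completes A (B - 1) to A B, so B divides A (1 + x).
        eq₂ : B * (e * w + y + 1) + A * suc x ≡ B * (A + e * p)
        eq₂ = +-cancelˡ-≡ c _ _ (*-cancelˡ-≡ _ _ m (begin
          m * (c + (B * (e * w + y + 1) + A * suc x))
            ≡⟨ regroup m A B e x y w ⟩
          m * (A * x + B * y + B) + c * (suc w * m) + m * A
            ≡⟨ cong (λ z → m * (A * x + B * y + B) + c * z + m * A) (sym 1+z≡) ⟩
          m * (A * x + B * y + B) + c * suc z + m * A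
            ≡⟨ cong (_+ m * A) eq₁ ⟩
          m * (c + A * B′ + B * (e * p)) + m * A
            ≡⟨ regroup′ m A B′ e p ⟩
          m * (c + B * (A + e * p)) ∎))
          where
          regroup : ∀ m A B e x y w → m * (B * e + (B * (e * w + y + 1) + A * (1 + x)))
            ≡ m * (A * x + B * y + B) + B * e * ((1 + w) * m) + m * A
          regroup = solve-∀
          regroup′ : ∀ m A B′ e p →
            m * ((1 + B′) * e + A * B′ + (1 + B′) * (e * p)) + m * A
            ≡ m * ((1 + B′) * e + (1 + B′) * (A + e * p))
          regroup′ = solve-∀

  -- As r and s are at most m - 1 and B - 1, exceeding N forces K ≥ e p. The points counted before
  -- still fit, and (0 , p) is one more.
  count-above-frobenius : ∀ p M → m′ * c + B′ * (m * A) + m * B * (e * p) < M + m * B →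
    sumTo p (λ j → ceilDiv (e * j) A) < d M coefficients
  count-above-frobenius p M large
    -- Decomposing M + m B instead of M raises K by one, so the bound to reach is e p < K. It also
    -- ensures the size that `represent` asks for.
    with r , t , r≤m′ , M-eq ← represent c c*i′≡1+m*v′ (M + m * B)
           (≤-trans (≤-reflexive (*-comm c m′))
             (≤-trans (m≤m+n _ _) (≤-trans (m≤m+n _ (m * B * (e * p))) (<⇒≤ large))))
    -- Replacing r by its maximum keeps the strict inequality, which passes to t; the same with s
    -- then passes it to K.
    with A*B′+B*e*p<t ← *-cancelˡ-< m (A * B′ + B * (e * p)) t (+-cancelˡ-< (c * r) _ _
           (≤-trans (s≤s (≤-trans (+-monoˡ-≤ _ (≤-trans (*-monoʳ-≤ c r≤m′) (≤-reflexive (*-comm c m′))))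
              (≤-reflexive (regroup-bound (m′ * c) m A B B′ (e * p)))))
             (≤-trans large (≤-reflexive M-eq))))
    with s , K , s≤B′ , t-eq ← represent A A*i≡1+B*v t
           (≤-trans (m≤m+n _ (B * (e * p))) (<⇒≤ A*B′+B*e*p<t))
    with e*p<K ← *-cancelˡ-< B (e * p) K (+-cancelˡ-< (A * s) _ _
           (≤-trans (s≤s (+-monoˡ-≤ _ (*-monoʳ-≤ A s≤B′)))
             (≤-trans A*B′+B*e*p<t (≤-reflexive t-eq))))
    = enough {r} {s} K e*p<K M-eq t-eq
    where
    enough : ∀ {r s t} K → e * p < K → M + m * B ≡ c * r + m * t → t ≡ A * s + B * K →
      sumTo p (λ j → ceilDiv (e * j) A) < d M coefficients
    enough {r} {s} (suc K) (s≤s e*p≤K) M-eq refl =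
      subst (_≤ d M coefficients)
        (trans (length-map _ points) (cong suc (length-latticePoints A e p)))
        (length≤d (map (solution s r K) points) nonZero
          (Unique.map⁺ solution-injective points-unique) sound)
      where
      points : List (ℕ × ℕ)
      points = (0 , p) ∷ latticePoints A e p

      points-unique : Unique points
      points-unique = All.tabulate (λ { mem refl → <-irrefl refl
          (≤-<-trans (m≤n+m (e * p) (A * 0)) (∈-latticePoints⁻ A e p mem)) })
        ∷ latticePoints-unique A e p

      nonZero : All NonZero coefficients
      nonZero = m*n≢0 m A ∷ _ ∷ m*n≢0 B e ∷ []

      below : ∀ x → x ∈ points → A * proj₁ x + e * proj₂ x ≤ K
      below _ (here refl) = ≤-trans (≤-reflexive (cong (_+ e * p) (*-zeroʳ A))) e*p≤K
      below _ (there mem) = ≤-trans (<⇒≤ (∈-latticePoints⁻ A e p mem)) e*p≤K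

      sound : ∀ {xs} → xs ∈ map (solution s r K) points → weight coefficients xs ≡ M
      sound mem with ∈-map⁻ _ mem
      ... | x , x∈ , refl = trans (weight-solution x (below x x∈))
        (+-cancelʳ-≡ (m * B) _ _ (trans (add (c * r) m (A * s) B K) (sym M-eq)))
        where
        add : ∀ x m y B K → x + m * (y + B * K) + m * B ≡ x + m * (y + B * (1 + K))
        add = solve-∀

  isGenFrobenius : ∀ p N → N + m * B ≡ m′ * c + B′ * (m * A) + m * B * (e * p) →
    IsGenFrobenius coefficients (sumTo p (λ j → ceilDiv (e * j) A)) N
  isGenFrobenius p N N-eq = count-at-frobenius p N N-eq , λ M N<M →
    count-above-frobenius p M (subst (_< M + m * B) N-eq (+-monoˡ-< (m * B) N<M))

-- Specialisation to triangular numbers.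

tri-half : ∀ x y → x * (1 + x) ≡ y * 2 → tri x ≡ y
tri-half x y eq = trans (cong (_/ 2) eq) (m*n/n≡m y 2)

triple-cong : ∀ {x x′ y y′ z z′ : ℕ} → x ≡ x′ → y ≡ y′ → z ≡ z′ →
  _≡_ {A = List ℕ} (x ∷ y ∷ z ∷ []) (x′ ∷ y′ ∷ z′ ∷ [])
triple-cong refl refl refl = refl

IsGenFrobenius-cong : ∀ {as as′ q q′ N} → as ≡ as′ → q ≡ q′ →
  IsGenFrobenius as q N → IsGenFrobenius as′ q′ N
IsGenFrobenius-cong refl refl frob = frob

-- Turns the closed form with its division and truncated subtraction into the additive equation of
-- `isGenFrobenius`; Y > 0 makes `∸ 1` exact.
quarter∸1+ : ∀ {x b R} Y .{{_ : NonZero Y}} → x ≡ Y * 4 → Y + b ≡ 1 + R → x / 4 ∸ 1 + b ≡ R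
quarter∸1+ {b = b} (suc Y) refl eq =
  trans (cong (λ y → y ∸ 1 + b) (m*n/n≡m (suc Y) 4)) (suc-injective eq)

triangular-even : ∀ p l → let n = suc l * 2 in
  IsGenFrobenius (tri n ∷ tri (n + 1) ∷ tri (n + 2) ∷ [])
    (p * (p + 1) + sumTo p (λ j → ceilDiv (6 * j) n))
    (((n + 1) * (n + 2) * (2 * (n + 3) * p + 3 * n)) / 4 ∸ 1)
triangular-even p l = IsGenFrobenius-cong
      (sym (coefficients-eq k))
      (trans (sumTo-cong p ceilDiv-eq) (sumTo-2*j+ p (λ j → ceilDiv (6 * j) (suc l * 2))))
      (isGenFrobenius k k (2 * k) (3 + 2 * k)
        -- k is its own inverse modulo k + 1, as k k = 1 + (k + 1)(k - 1); and c = (k + 1)(2 k + 3)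
        -- is 1 modulo 2 k + 1.
        {i = k} {v = l} {i′ = 1} {v′ = 2 + k}
        (A-invertible l) (c-invertible k) p _ (quarter∸1+ Y (numerator k p) (N-eq k p)))
  where
  k Y : ℕ
  k = suc l
  Y = (1 + 2 * k) * (1 + k) * ((3 + 2 * k) * p + 3 * k)

  instance
    Y≢0 : NonZero Y
    Y≢0 = m*n≢0 ((1 + 2 * k) * (1 + k)) _ {{_}}
      {{>-nonZero (≤-trans (s≤s z≤n) (m≤n+m (3 * k) ((3 + 2 * k) * p)))}}

  tri₀ : ∀ k → k * 2 * (1 + k * 2) ≡ (1 + 2 * k) * k * 2
  tri₀ = solve-∀
  tri₁ : ∀ k → (k * 2 + 1) * (1 + (k * 2 + 1)) ≡ (1 + 2 * k) * (1 + k) * 2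
  tri₁ = solve-∀
  tri₂ : ∀ k → (k * 2 + 2) * (1 + (k * 2 + 2)) ≡ (1 + k) * (3 + 2 * k) * 2
  tri₂ = solve-∀
  coefficients-eq : ∀ k → let n = k * 2 in
    _≡_ {A = List ℕ} (tri n ∷ tri (n + 1) ∷ tri (n + 2) ∷ [])
      ((1 + 2 * k) * k ∷ (1 + 2 * k) * (1 + k) ∷ (1 + k) * (3 + 2 * k) ∷ [])
  coefficients-eq k = triple-cong (tri-half (k * 2) _ (tri₀ k))
    (tri-half (k * 2 + 1) _ (tri₁ k)) (tri-half (k * 2 + 2) _ (tri₂ k))
  A-invertible : ∀ l → (1 + l) * (1 + l) ≡ 1 + (2 + l) * l
  A-invertible = solve-∀
  c-invertible : ∀ k → (1 + k) * (3 + 2 * k) * 1 ≡ 1 + (1 + 2 * k) * (2 + k)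
  c-invertible = solve-∀
  numerator : ∀ k p → (k * 2 + 1) * (k * 2 + 2) * (2 * (k * 2 + 3) * p + 3 * (k * 2))
    ≡ (1 + 2 * k) * (1 + k) * ((3 + 2 * k) * p + 3 * k) * 4
  numerator = solve-∀
  N-eq : ∀ k p → (1 + 2 * k) * (1 + k) * ((3 + 2 * k) * p + 3 * k) + (1 + 2 * k) * (1 + k)
    ≡ 1 + (2 * k * ((1 + k) * (3 + 2 * k)) + k * ((1 + 2 * k) * k)
             + (1 + 2 * k) * (1 + k) * ((3 + 2 * k) * p))
  N-eq = solve-∀

  -- Here e j / A = 2 j + 3 j / k = 2 j + 6 j / n; the terms 2 j sum to p (p + 1).
  ceilDiv-eq : ∀ j → ceilDiv ((3 + 2 * k) * j) k ≡ 2 * j + ceilDiv (6 * j) (k * 2)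
  ceilDiv-eq j = begin
    ceilDiv ((3 + 2 * k) * j) k              ≡⟨ cong (λ x → ceilDiv x k) (split k j) ⟩
    ceilDiv (2 * j * k + 3 * j) k            ≡⟨ ceilDiv-+-* (2 * j) (3 * j) k ⟩
    2 * j + ceilDiv (3 * j) k                ≡⟨ cong (2 * j +_) (sym (ceilDiv-cancel-2 (3 * j) k)) ⟩
    2 * j + ceilDiv (2 * (3 * j)) (2 * k)
      ≡⟨ cong₂ (λ x y → 2 * j + ceilDiv x y) (sym (*-assoc 2 3 j)) (*-comm 2 k) ⟩
    2 * j + ceilDiv (6 * j) (k * 2)          ∎
    where
    open ≡-Reasoning
    split : ∀ k j → (3 + 2 * k) * j ≡ 2 * j * k + 3 * j
    split = solve-∀

triangular-odd : ∀ p l → let n = 1 + suc l * 2 in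
  IsGenFrobenius (tri n ∷ tri (n + 1) ∷ tri (n + 2) ∷ [])
    (sumTo p (λ j → ceilDiv (j * (n + 3)) (2 * n)))
    (((n + 1) * (n + 2) * ((n + 3) * p + 3 * (n ∸ 1))) / 4 ∸ 1)
triangular-odd p l = IsGenFrobenius-cong
      (sym (coefficients-eq k)) (sumTo-cong p ceilDiv-eq)
      (isGenFrobenius (1 + 2 * k) (2 + 2 * k) k (2 + k)
        -- (2 k + 1)(k + 1) = 1 + (2 k + 3) k gives the inverse of A modulo B; c = (2 k + 3)(k + 2)
        -- is 1 modulo k + 1.
        {i = 1 + k} {v = k} {i′ = 1} {v′ = 2 * k + 5}
        (A-invertible k) (c-invertible k) p _ (quarter∸1+ Y (numerator k p) (N-eq k p)))
  where
  k Y : ℕ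
  k = suc l
  Y = (1 + k) * (3 + 2 * k) * ((2 + k) * p + 3 * k)

  instance
    Y≢0 : NonZero Y
    Y≢0 = m*n≢0 ((1 + k) * (3 + 2 * k)) _ {{_}}
      {{>-nonZero (≤-trans (s≤s z≤n) (m≤n+m (3 * k) ((2 + k) * p)))}}

  tri₀ : ∀ k → (1 + k * 2) * (1 + (1 + k * 2)) ≡ (1 + k) * (1 + 2 * k) * 2
  tri₀ = solve-∀
  tri₁ : ∀ k → (1 + k * 2 + 1) * (1 + (1 + k * 2 + 1)) ≡ (1 + k) * (3 + 2 * k) * 2
  tri₁ = solve-∀
  tri₂ : ∀ k → (1 + k * 2 + 2) * (1 + (1 + k * 2 + 2)) ≡ (3 + 2 * k) * (2 + k) * 2
  tri₂ = solve-∀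
  coefficients-eq : ∀ k → let n = 1 + k * 2 in
    _≡_ {A = List ℕ} (tri n ∷ tri (n + 1) ∷ tri (n + 2) ∷ [])
      ((1 + k) * (1 + 2 * k) ∷ (1 + k) * (3 + 2 * k) ∷ (3 + 2 * k) * (2 + k) ∷ [])
  coefficients-eq k = triple-cong (tri-half (1 + k * 2) _ (tri₀ k))
    (tri-half (1 + k * 2 + 1) _ (tri₁ k)) (tri-half (1 + k * 2 + 2) _ (tri₂ k))
  A-invertible : ∀ k → (1 + 2 * k) * (1 + k) ≡ 1 + (3 + 2 * k) * k
  A-invertible = solve-∀
  c-invertible : ∀ k → (3 + 2 * k) * (2 + k) * 1 ≡ 1 + (1 + k) * (2 * k + 5)
  c-invertible = solve-∀
  numerator : ∀ k p →
    (1 + k * 2 + 1) * (1 + k * 2 + 2) * ((1 + k * 2 + 3) * p + 3 * (k * 2))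
    ≡ (1 + k) * (3 + 2 * k) * ((2 + k) * p + 3 * k) * 4
  numerator = solve-∀
  N-eq : ∀ k p → (1 + k) * (3 + 2 * k) * ((2 + k) * p + 3 * k) + (1 + k) * (3 + 2 * k)
    ≡ 1 + (k * ((3 + 2 * k) * (2 + k)) + (2 + 2 * k) * ((1 + k) * (1 + 2 * k))
             + (1 + k) * (3 + 2 * k) * ((2 + k) * p))
  N-eq = solve-∀

  -- Since n + 3 = 2 (k + 2), the ratio e / A equals (n + 3) / (2 n), that is, (1 + 3 / n) / 2.
  ceilDiv-eq : ∀ j →
    ceilDiv ((2 + k) * j) (1 + 2 * k) ≡ ceilDiv (j * (1 + k * 2 + 3)) (2 * (1 + k * 2))
  ceilDiv-eq j = trans (sym (ceilDiv-cancel-2 ((2 + k) * j) (1 + 2 * k)))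
    (cong₂ ceilDiv (double k j) (cong (λ x → 2 * (1 + x)) (*-comm 2 k)))
    where
    double : ∀ k j → 2 * ((2 + k) * j) ≡ j * (1 + k * 2 + 3)
    double = solve-∀

odd-witness : ∀ {n} → ¬ 2 ∣ n → 3 ≤ n → ∃ λ l → n ≡ 1 + suc l * 2
odd-witness {n} 2∤n 3≤n with n % 2 | n / 2 | m%n<n n 2 | m≡m%n+[m/n]*n n 2
... | 0 | q | _ | n≡ = contradiction (divides q n≡) 2∤n
... | 1 | zero | _ | n≡ = contradiction (subst (3 ≤_) n≡ 3≤n) λ { (s≤s ()) }
... | 1 | suc l | _ | n≡ = l , n≡
... | suc (suc _) | _ | s≤s (s≤s ()) | _

theorem1 : (p : ℕ) →
    ((n : ℕ) → 2 ∣ n → 2 ≤ n →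
    IsGenFrobenius (tri n ∷ tri (n + 1) ∷ tri (n + 2) ∷ [])
    (p * (p + 1) + sumTo p (λ j → ceilDiv (6 * j) n))
    (((n + 1) * (n + 2) * (2 * (n + 3) * p + 3 * n)) / 4 ∸ 1))
    ×
    ((n : ℕ) → ¬ (2 ∣ n) → 3 ≤ n →
    IsGenFrobenius (tri n ∷ tri (n + 1) ∷ tri (n + 2) ∷ [])
    (sumTo p (λ j → ceilDiv (j * (n + 3)) (2 * n)))
    (((n + 1) * (n + 2) * ((n + 3) * p + 3 * (n ∸ 1))) / 4 ∸ 1))
theorem1 p = even , odd
  where
  even : ∀ n → 2 ∣ n → 2 ≤ n → _
  even n (divides (suc l) refl) _ = triangular-even p l

  odd : ∀ n → ¬ (2 ∣ n) → 3 ≤ n → _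
  odd n 2∤n 3≤n with odd-witness 2∤n 3≤n
  ... | l , refl = triangular-odd p l
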